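{- The logic $\mathcal{LB}_\supset$ is algebraizable with respect to the variety $\mathsf{ImpBiLat}$ of implicative bilattices, with equivalence formula $\varphi\leftrightarrow\psi$ and defining equation $\varphi\approx\varphi\supset\varphi$.
   Context: A bilattice is an algebra $\langle B,\land,\lor,\otimes,\oplus,\neg\rangle$ such that $\langle B,\land,\lor\rangle$ and $\langle B,\otimes,\oplus\rangle$ are lattices (not necessarily bounded) with orders $\leq_t$ and $\leq_k$, and $\neg$ is unary with: $a\leq_t b\Rightarrow\neg b\leq_t\neg a$; $a\leq_k b\Rightarrow\neg a\leq_k\neg b$; $\neg\neg a=a$. An implicative bilattice is an algebra $\langle B,\land,\lor,\otimes,\oplus,\supset,\neg\rangle$ whose $\supset$-free reduct is a bilattice and which satisfies: (IB1) $(x\supset x)\supset y\approx y$; (IB2) $x\supset(y\supset z)\approx(x\land y)\supset z\approx(x\otimes y)\supset z$; (IB3) $((x\supset y)\supset x)\supset x\approx x\supset x$; (IB4) $(x\lor y)\supset z\approx(x\supset z)\land(y\supset z)\approx(x\oplus y)\supset z$; (IB5) $x\land((x\supset y)\supset(x\otimes y))\approx x$; (IB6) $\neg(x\supset y)\supset z\approx(x\land\neg y)\supset z$. $\mathbf{Fm}$ is the formula algebra over a countable set of variables in the language $\{\land,\lor,\otimes,\oplus,\supset,\neg\}$. A prime bifilter of a bilattice $\mathbf B$ is a proper non-empty $F\subsetneq B$ that is a prime lattice filter with respect to both $\leq_t$ and $\leq_k$. If $\mathbf B$ has a $\leq_t$-maximum $\mathsf t$ and $F$ is a prime bifilter, let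 $\mathbf B_\supset$ be $\mathbf B$ expanded by $a\supset b=b$ if $a\in F$ and $a\supset b=\mathsf t$ if $a\notin F$. $\mathcal{LB}_\supset$ is the logic given by: $\Gamma\models_{\mathcal{LB}_\supset}\varphi$ iff for all such $\langle\mathbf B_\supset,F\rangle$ and all homomorphisms $v:\mathbf{Fm}\to\mathbf B_\supset$, $v[\Gamma]\subseteq F$ implies $v(\varphi)\in F$. Known facts (Arieli–Avron), which may be used as equivalent definitions of $\mathcal{LB}_\supset$: (a) $\models_{\mathcal{LB}_\supset}$ coincides with the consequence of the single matrix $\langle\mathcal{FOUR}_\supset,\{\top,\mathsf t\}\rangle$, where $\mathcal{FOUR}$ is the bilattice on $\{\mathsf f,\bot,\top,\mathsf t\}$ with $\mathsf f<_t\bot,\top<_t\mathsf t$, $\bot<_k\mathsf f,\mathsf t<_k\top$, $\neg\mathsf f=\mathsf t$, $\neg\mathsf t=\mathsf f$, $\neg\bot=\bot$, $\neg\top=\top$, and $\mathcal{FOUR}_\supset$ is its expansion by the operation $a\supset b=b$ if $a\in\{\top,\mathsf t\}$ and $a\supset b=\mathsf t$ if $a\in\{\mathsf f,\bot\}$; (b) it coincides with the consequence relation of the Hilbert calculus with modus ponens (from $p$, $p\supset q$ infer $q$) as only rule and axioms: $p\supset(q\supset p)$; $(p\supset(q\supset r))\supset((p\supset q)\supset(p\supset r))$; $((p\supset q)\supset p)\supset p$; $(p\land q)\supset p$; $(p\land q)\supset q$; $p\supset(q\supset(p\land q))$; $(p\otimes q)\supset p$; $(p\otimes q)\supset q$;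 $p\supset(q\supset(p\otimes q))$; $p\supset(p\lor q)$; $q\supset(p\lor q)$; $(p\supset r)\supset((q\supset r)\supset((p\lor q)\supset r))$; $p\supset(p\oplus q)$; $q\supset(p\oplus q)$; $(p\supset r)\supset((q\supset r)\supset((p\oplus q)\supset r))$; $\neg(p\land q)\equiv(\neg p\lor\neg q)$; $\neg(p\lor q)\equiv(\neg p\land\neg q)$; $\neg(p\otimes q)\equiv(\neg p\otimes\neg q)$; $\neg(p\oplus q)\equiv(\neg p\oplus\neg q)$; $\neg(p\supset q)\equiv(p\land\neg q)$; $p\equiv\neg\neg p$; where $\varphi\equiv\psi$ abbreviates $(\varphi\supset\psi)\land(\psi\supset\varphi)$. Abbreviations: $p\to q:=(p\supset q)\land(\neg q\supset\neg p)$; $p\leftrightarrow q:=(p\to q)\land(q\to p)$. Algebraizability (Blok–Pigozzi) of a logic $\vdash$ with respect to a variety $\mathsf K$ with equivalence formula $\varphi\leftrightarrow\psi$ and defining equation $\varphi\approx\varphi\supset\varphi$ means: (1) for all $\Gamma\cup\{\varphi\}\subseteq Fm$, $\Gamma\vdash\varphi$ iff $\{\gamma\approx\gamma\supset\gamma:\gamma\in\Gamma\}\models_{\mathsf K}\varphi\approx\varphi\supset\varphi$; and (2) for all formulas $\varphi,\psi$, the equation $\varphi\approx\psi$ and the equation $(\varphi\leftrightarrow\psi)\approx(\varphi\leftrightarrow\psi)\supset(\varphi\leftrightarrow\psi)$ are interderivable in the equational consequence $\models_{\mathsf K}$. -}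

module Defs where

open import Algebra.Core using (Op₁; Op₂)
open import Algebra.Definitions using (Congruent₁; Congruent₂; Involutive)
open import Algebra.Lattice.Structures using (IsLattice)
open import Data.Nat.Base using (ℕ)
open import Data.Product.Base using (_×_; ∃-syntax)
open import Function.Bundles using (_⇔_)
open import Level using (Level; _⊔_; suc; 0ℓ)
open import Relation.Binary.Core using (Rel)
open import Relation.Binary.PropositionalEquality.Core using (_≡_)
open import Relation.Binary.Structures using (IsEquivalence)
open import Relation.Unary using (Pred; _∈_; ｛_｝)
import Relation.Binary.Construct.NaturalOrder.Left as NaturalOrder

private
  variable
    c ℓ k : Level

------------------------------------------------------------------------
-- Algebras in the language {∧, ∨, ⊗, ⊕, ⊃, ¬}

-- As in the standard library, the carrier comes with its own equality,
-- so quotients of algebras are algebras.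

record Algebra (c ℓ : Level) : Set (suc (c ⊔ ℓ)) where
  infix  8 ¬_
  infixr 7 _∧_ _⊗_
  infixr 6 _∨_ _⊕_
  infixr 5 _⊃_
  infix  4 _≈_
  field
    Carrier       : Set c
    _≈_           : Rel Carrier ℓ
    isEquivalence : IsEquivalence _≈_
    _∧_           : Op₂ Carrier
    _∨_           : Op₂ Carrier
    _⊗_           : Op₂ Carrier
    _⊕_           : Op₂ Carrier
    _⊃_           : Op₂ Carrier
    ¬_            : Op₁ Carrier
    ∧-cong        : Congruent₂ _≈_ _∧_
    ∨-cong        : Congruent₂ _≈_ _∨_
    ⊗-cong        : Congruent₂ _≈_ _⊗_
    ⊕-cong        : Congruent₂ _≈_ _⊕_
    ⊃-cong        : Congruent₂ _≈_ _⊃_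
    ¬-cong        : Congruent₁ _≈_ ¬_

  open NaturalOrder _≈_ _∧_ public using () renaming (_≤_ to _≤ₜ_)
  open NaturalOrder _≈_ _⊗_ public using () renaming (_≤_ to _≤ₖ_)

-- A condition on the ⊃-free reduct only.

record IsBilattice (B : Algebra c ℓ) : Set (c ⊔ ℓ) where
  open Algebra B
  field
    isLatticeₜ   : IsLattice _≈_ _∨_ _∧_
    isLatticeₖ   : IsLattice _≈_ _⊕_ _⊗_
    ¬-antitoneₜ  : ∀ {a b} → a ≤ₜ b → ¬ b ≤ₜ ¬ a
    ¬-monotoneₖ  : ∀ {a b} → a ≤ₖ b → ¬ a ≤ₖ ¬ b
    ¬-involutive : Involutive _≈_ ¬_

record IsImplicativeBilattice (B : Algebra c ℓ) : Set (c ⊔ ℓ) where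
  open Algebra B
  field
    isBilattice : IsBilattice B
    IB1  : ∀ x y → (x ⊃ x) ⊃ y ≈ y
    IB2∧ : ∀ x y z → x ⊃ (y ⊃ z) ≈ (x ∧ y) ⊃ z
    IB2⊗ : ∀ x y z → (x ∧ y) ⊃ z ≈ (x ⊗ y) ⊃ z
    IB3  : ∀ x y → ((x ⊃ y) ⊃ x) ⊃ x ≈ x ⊃ x
    IB4∨ : ∀ x y z → (x ∨ y) ⊃ z ≈ (x ⊃ z) ∧ (y ⊃ z)
    IB4⊕ : ∀ x y z → (x ⊃ z) ∧ (y ⊃ z) ≈ (x ⊕ y) ⊃ z
    IB5  : ∀ x y → x ∧ ((x ⊃ y) ⊃ (x ⊗ y)) ≈ x
    IB6  : ∀ x y z → ¬ (x ⊃ y) ⊃ z ≈ (x ∧ ¬ y) ⊃ z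

ImpBiLat : (c ℓ : Level) → Pred (Algebra c ℓ) (c ⊔ ℓ)
ImpBiLat c ℓ B = IsImplicativeBilattice B

------------------------------------------------------------------------
-- Formulas

infix  8 ¬_
infixr 7 _∧_ _⊗_
infixr 6 _∨_ _⊕_
infixr 5 _⊃_

data Fm : Set where
  var : ℕ → Fm
  _∧_ : Fm → Fm → Fm
  _∨_ : Fm → Fm → Fm
  _⊗_ : Fm → Fm → Fm
  _⊕_ : Fm → Fm → Fm
  _⊃_ : Fm → Fm → Fm
  ¬_  : Fm → Fm

infix 4 _⊃⊂_ _⟶_ _⟷_

-- Written ≡, → and ↔ in the literature.

_⊃⊂_ : Fm → Fm → Fm
φ ⊃⊂ ψ = (φ ⊃ ψ) ∧ (ψ ⊃ φ)

_⟶_ : Fm → Fm → Fm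
φ ⟶ ψ = (φ ⊃ ψ) ∧ (¬ ψ ⊃ ¬ φ)

_⟷_ : Fm → Fm → Fm
φ ⟷ ψ = (φ ⟶ ψ) ∧ (ψ ⟶ φ)

------------------------------------------------------------------------
-- The logic LB⊃, presented by the Hilbert calculus of Arieli and Avron

data Axiom : Fm → Set where
  ⊃1    : ∀ p q → Axiom (p ⊃ (q ⊃ p))
  ⊃2    : ∀ p q r → Axiom ((p ⊃ (q ⊃ r)) ⊃ ((p ⊃ q) ⊃ (p ⊃ r)))
  ⊃3    : ∀ p q → Axiom (((p ⊃ q) ⊃ p) ⊃ p)
  ∧⊃ˡ   : ∀ p q → Axiom ((p ∧ q) ⊃ p)
  ∧⊃ʳ   : ∀ p q → Axiom ((p ∧ q) ⊃ q)
  ⊃∧    : ∀ p q → Axiom (p ⊃ (q ⊃ (p ∧ q)))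
  ⊗⊃ˡ   : ∀ p q → Axiom ((p ⊗ q) ⊃ p)
  ⊗⊃ʳ   : ∀ p q → Axiom ((p ⊗ q) ⊃ q)
  ⊃⊗    : ∀ p q → Axiom (p ⊃ (q ⊃ (p ⊗ q)))
  ⊃∨ˡ   : ∀ p q → Axiom (p ⊃ (p ∨ q))
  ⊃∨ʳ   : ∀ p q → Axiom (q ⊃ (p ∨ q))
  ∨⊃    : ∀ p q r → Axiom ((p ⊃ r) ⊃ ((q ⊃ r) ⊃ ((p ∨ q) ⊃ r)))
  ⊃⊕ˡ   : ∀ p q → Axiom (p ⊃ (p ⊕ q))
  ⊃⊕ʳ   : ∀ p q → Axiom (q ⊃ (p ⊕ q))
  ⊕⊃    : ∀ p q r → Axiom ((p ⊃ r) ⊃ ((q ⊃ r) ⊃ ((p ⊕ q) ⊃ r)))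
  ¬∧    : ∀ p q → Axiom (¬ (p ∧ q) ⊃⊂ (¬ p ∨ ¬ q))
  ¬∨    : ∀ p q → Axiom (¬ (p ∨ q) ⊃⊂ (¬ p ∧ ¬ q))
  ¬⊗    : ∀ p q → Axiom (¬ (p ⊗ q) ⊃⊂ (¬ p ⊗ ¬ q))
  ¬⊕    : ∀ p q → Axiom (¬ (p ⊕ q) ⊃⊂ (¬ p ⊕ ¬ q))
  ¬⊃    : ∀ p q → Axiom (¬ (p ⊃ q) ⊃⊂ (p ∧ ¬ q))
  ¬¬    : ∀ p → Axiom (p ⊃⊂ (¬ ¬ p))

infix 3 _⊢LB⊃_

data _⊢LB⊃_ (Γ : Pred Fm ℓ) : Fm → Set ℓ where
  hyp   : ∀ {φ} → φ ∈ Γ → Γ ⊢LB⊃ φ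
  axiom : ∀ {φ} → Axiom φ → Γ ⊢LB⊃ φ
  mp    : ∀ {φ ψ} → Γ ⊢LB⊃ φ → Γ ⊢LB⊃ φ ⊃ ψ → Γ ⊢LB⊃ ψ

------------------------------------------------------------------------
-- Equational consequence

infix 4 _≈_

data Equation : Set where
  _≈_ : Fm → Fm → Equation

module _ (B : Algebra c ℓ) where
  private module B = Algebra B

  -- The unique homomorphism Fm → B extending an assignment.
  eval : (ℕ → B.Carrier) → Fm → B.Carrier
  eval v (var n) = v n
  eval v (φ ∧ ψ) = eval v φ B.∧ eval v ψ
  eval v (φ ∨ ψ) = eval v φ B.∨ eval v ψ
  eval v (φ ⊗ ψ) = eval v φ B.⊗ eval v ψ
  eval v (φ ⊕ ψ) = eval v φ B.⊕ eval v ψ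
  eval v (φ ⊃ ψ) = eval v φ B.⊃ eval v ψ
  eval v (¬ φ)   = B.¬ eval v φ

  Satisfies : (ℕ → B.Carrier) → Equation → Set ℓ
  Satisfies v (φ ≈ ψ) = eval v φ B.≈ eval v ψ

infix 3 _⊨[_]_

_⊨[_]_ : ∀ {e} → Pred Equation e → Pred (Algebra c ℓ) k → Equation →
         Set (e ⊔ k ⊔ suc (c ⊔ ℓ))
E ⊨[ K ] ε = ∀ B → B ∈ K → ∀ v →
             (∀ ε′ → ε′ ∈ E → Satisfies B v ε′) → Satisfies B v ε

------------------------------------------------------------------------
-- Algebraizability in the sense of Blok and Pigozzi, for a logic ⊢, a
-- class K, an equivalence formula Δ and a defining equation τ

image : (Fm → Equation) → Pred Fm ℓ → Pred Equation ℓ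
image τ Γ ε = ∃[ γ ] γ ∈ Γ × ε ≡ τ γ

record Algebraizable
  (_⊢_ : Pred Fm ℓ → Fm → Set ℓ)
  (K   : Pred (Algebra c ℓ) k)
  (Δ   : Fm → Fm → Fm)
  (τ   : Fm → Equation)
  : Set (k ⊔ suc (c ⊔ ℓ)) where
  field
    consequence : ∀ Γ φ → (Γ ⊢ φ) ⇔ (image τ Γ ⊨[ K ] τ φ)
    to          : ∀ φ ψ → ｛ φ ≈ ψ ｝ ⊨[ K ] τ (Δ φ ψ)
    from        : ∀ φ ψ → ｛ τ (Δ φ ψ) ｝ ⊨[ K ] (φ ≈ ψ)

{-# OPTIONS --safe #-}

-- Soundness and the recovery of equality are equational. Call a designated
-- when a ≈ a ⊃ a; by (IB1) this holds iff a ⊃ y ≈ y for all y. If a ⊃ b is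
-- designated, (IB5) gives a ≤ₜ a ⊗ b, from which modus ponens under a
-- premise follows. If moreover ¬ a ⊃ ¬ b is designated, then
-- ¬ a ≤ₜ ¬ a ⊗ ¬ b ≈ ¬ (a ⊗ b), so a ≈ a ⊗ b; by symmetry a ⟷ b
-- designated forces a ≈ a ⊗ b ≈ b.
--
-- For completeness, formulas ordered by Γ ⊢ φ ⊃ ψ form a relatively
-- pseudocomplemented lattice satisfying Peirce's law. Its twist product with
-- itself, which pairs evidence for with evidence against, is an implicative
-- bilattice, and under the valuation n ↦ (var n , ¬ var n) a formula φ is
-- evaluated as (φ , ¬ φ).

module Submission where

open import Algebra.Core using (Op₂)
import Algebra.Lattice.Bundles as Alg
import Algebra.Lattice.Properties.Lattice as AlgLatticeProperties
open import Data.Nat.Base using (ℕ)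
open import Data.Product.Base using (_×_; _,_; proj₁; proj₂; swap; zip)
open import Data.Product.Relation.Binary.Pointwise.NonDependent using (Pointwise; ×-isEquivalence)
open import Function.Bundles using (mk⇔)
open import Level using (Level; Lift; lift; lower; _⊔_)
open import Relation.Binary.Construct.Interior.Symmetric using (_,_; rhs≤lhs)
import Relation.Binary.Construct.Interior.Symmetric as Interior
open import Relation.Binary.Core using (Rel)
open import Relation.Binary.Lattice using (Lattice; MeetSemilattice; Exponential)
import Relation.Binary.Lattice.Properties.JoinSemilattice as JoinProperties
import Relation.Binary.Lattice.Properties.Lattice as LatticeProperties
import Relation.Binary.Lattice.Properties.MeetSemilattice as MeetProperties
open import Relation.Binary.PropositionalEquality.Core as ≡ using ()
import Relation.Binary.Reasoning.Setoid as ≈-Reasoning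
open import Relation.Binary.Structures using (IsEquivalence)
open import Relation.Unary using (Pred; _∈_)
open import Defs using (Algebra; IsBilattice; IsImplicativeBilattice)

private
  variable
    c ℓ ℓ₁ ℓ₂ ℓ₃ ℓ₄ : Level

-- Order isomorphisms and products of lattices.

-- Meets are determined by the order. Allowing two different semilattices lets one be an order dual,
-- which yields the De Morgan laws.
order-iso-preserves-∧ :
  (M : MeetSemilattice c ℓ₁ ℓ₂) (N : MeetSemilattice c ℓ₃ ℓ₄) →
  let module M = MeetSemilattice M; module N = MeetSemilattice N in
  (f : M.Carrier → N.Carrier) (g : N.Carrier → M.Carrier) →
  (∀ {x y} → x M.≤ y → f x N.≤ f y) →
  (∀ {x y} → x N.≤ y → g x M.≤ g y) →
  (∀ x → g (f x) M.≈ x) → (∀ y → f (g y) N.≈ y) →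
  ∀ x y → f (x M.∧ y) N.≈ f x N.∧ f y
order-iso-preserves-∧ M N f g f-mono g-mono gf fg x y = N.antisym
  (N.∧-greatest (f-mono (M.x∧y≤x x y)) (f-mono (M.x∧y≤y x y)))
  (N.trans (N.reflexive (N.Eq.sym (fg _))) (f-mono (M.∧-greatest
    (M.trans (g-mono (N.x∧y≤x _ _)) (M.reflexive (gf x)))
    (M.trans (g-mono (N.x∧y≤y _ _)) (M.reflexive (gf y))))))
  where
  module M = MeetSemilattice M
  module N = MeetSemilattice N

×-lattice : Alg.Lattice c ℓ₁ → Alg.Lattice c ℓ₂ → Alg.Lattice c (ℓ₁ ⊔ ℓ₂)
×-lattice L M = record
  { Carrier   = L.Carrier × M.Carrier
  ; _≈_       = Pointwise L._≈_ M._≈_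
  ; _∨_       = zip L._∨_ M._∨_
  ; _∧_       = zip L._∧_ M._∧_
  ; isLattice = record
    { isEquivalence = ×-isEquivalence L.isEquivalence M.isEquivalence
    ; ∨-comm        = λ _ _ → L.∨-comm _ _ , M.∨-comm _ _
    ; ∨-assoc       = λ _ _ _ → L.∨-assoc _ _ _ , M.∨-assoc _ _ _
    ; ∨-cong        = zip L.∨-cong M.∨-cong
    ; ∧-comm        = λ _ _ → L.∧-comm _ _ , M.∧-comm _ _
    ; ∧-assoc       = λ _ _ _ → L.∧-assoc _ _ _ , M.∧-assoc _ _ _
    ; ∧-cong        = zip L.∧-cong M.∧-cong
    ; absorptive    = (λ _ _ → L.∨-absorbs-∧ _ _ , M.∨-absorbs-∧ _ _)
                    , (λ _ _ → L.∧-absorbs-∨ _ _ , M.∧-absorbs-∨ _ _)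
    }
  }
  where
  module L = Alg.Lattice L
  module M = Alg.Lattice M

-- Negation and the lattice operations of a bilattice.

module BilatticeProperties {B : Algebra c ℓ} (isBilattice : IsBilattice B) where
  open Algebra B
  open IsBilattice isBilattice

  latticeₜ latticeₖ : Alg.Lattice c ℓ
  latticeₜ = record { isLattice = isLatticeₜ }
  latticeₖ = record { isLattice = isLatticeₖ }

  module T = Lattice (AlgLatticeProperties.∨-∧-orderTheoreticLattice latticeₜ)
  module K = Lattice (AlgLatticeProperties.∨-∧-orderTheoreticLattice latticeₖ)

  private
    T∨ K⊕ : MeetSemilattice c ℓ ℓ
    T∨ = JoinProperties.dualMeetSemilattice T.joinSemilattice
    K⊕ = JoinProperties.dualMeetSemilattice K.joinSemilattice

  -- Negation is its own inverse and reverses `≤ₜ`, so it is an isomorphism of the truth order onto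
  -- its dual.
  ¬-∧ : ∀ x y → ¬ (x ∧ y) ≈ ¬ x ∨ ¬ y
  ¬-∧ = order-iso-preserves-∧ T.meetSemilattice T∨ ¬_ ¬_
          ¬-antitoneₜ ¬-antitoneₜ ¬-involutive ¬-involutive

  ¬-∨ : ∀ x y → ¬ (x ∨ y) ≈ ¬ x ∧ ¬ y
  ¬-∨ = order-iso-preserves-∧ T∨ T.meetSemilattice ¬_ ¬_
          ¬-antitoneₜ ¬-antitoneₜ ¬-involutive ¬-involutive

  ¬-⊗ : ∀ x y → ¬ (x ⊗ y) ≈ ¬ x ⊗ ¬ y
  ¬-⊗ = order-iso-preserves-∧ K.meetSemilattice K.meetSemilattice ¬_ ¬_
          ¬-monotoneₖ ¬-monotoneₖ ¬-involutive ¬-involutive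

  ¬-⊕ : ∀ x y → ¬ (x ⊕ y) ≈ ¬ x ⊕ ¬ y
  ¬-⊕ = order-iso-preserves-∧ K⊕ K⊕ ¬_ ¬_
          ¬-monotoneₖ ¬-monotoneₖ ¬-involutive ¬-involutive

-- Designated elements of an implicative bilattice.

module ImplicativeBilatticeProperties
  {B : Algebra c ℓ} (isImplicative : IsImplicativeBilattice B) where

  open Algebra B
  open IsImplicativeBilattice isImplicative
  open IsBilattice isBilattice
  open BilatticeProperties isBilattice
  open IsEquivalence isEquivalence
  open ≈-Reasoning (Alg.Lattice.setoid latticeₜ)

  private
    variable
      x y z : Carrier

  Designated : Pred Carrier ℓ
  Designated x = x ≈ x ⊃ x

  designated⇒⊃-identityˡ : Designated x → ∀ y → x ⊃ y ≈ y
  designated⇒⊃-identityˡ {x} d y = trans (⊃-cong d refl) (IB1 x y)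

  ⊃-identityˡ⇒designated : (∀ y → x ⊃ y ≈ y) → Designated x
  ⊃-identityˡ⇒designated {x} h = sym (h x)

  designated-resp-≈ : x ≈ y → Designated x → Designated y
  designated-resp-≈ x≈y d = trans (sym x≈y) (trans d (⊃-cong x≈y x≈y))

  x⊃x-designated : ∀ x → Designated (x ⊃ x)
  x⊃x-designated x = ⊃-identityˡ⇒designated (IB1 x)

  designated-mp : Designated x → Designated (x ⊃ y) → Designated y
  designated-mp dx = designated-resp-≈ (designated⇒⊃-identityˡ dx _)

  -- A designated `x` can be put in front of `y ⊃ z`; (IB2) then merges `x` and `y` into `x ∧ y`,
  -- which is `x`.
  designated-≤ₜ : x ≤ₜ y → Designated x → Designated y
  designated-≤ₜ {x} {y} x≤y d = ⊃-identityˡ⇒designated λ z → begin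
    y ⊃ z        ≈⟨ designated⇒⊃-identityˡ d _ ⟨
    x ⊃ (y ⊃ z)  ≈⟨ IB2∧ x y z ⟩
    (x ∧ y) ⊃ z  ≈⟨ ⊃-cong x≤y refl ⟨
    x ⊃ z        ≈⟨ designated⇒⊃-identityˡ d z ⟩
    z            ∎

  designated-∧ : Designated x → Designated y → Designated (x ∧ y)
  designated-∧ {x} {y} dx dy = ⊃-identityˡ⇒designated λ z → begin
    (x ∧ y) ⊃ z  ≈⟨ IB2∧ x y z ⟨
    x ⊃ (y ⊃ z)  ≈⟨ designated⇒⊃-identityˡ dx _ ⟩
    y ⊃ z        ≈⟨ designated⇒⊃-identityˡ dy z ⟩
    z            ∎

  designated-∧⁻ˡ : Designated (x ∧ y) → Designated x
  designated-∧⁻ˡ = designated-≤ₜ (T.x∧y≤x _ _)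

  designated-∧⁻ʳ : Designated (x ∧ y) → Designated y
  designated-∧⁻ʳ = designated-≤ₜ (T.x∧y≤y _ _)

  -- The left identity `y ⊃ y` is rewritten by absorption so that an arbitrary `x` appears; (IB4)
  -- then splits the implication into the meet of `y` and `x ⊃ y`.
  y≤ₜx⊃y : ∀ x y → y ≤ₜ x ⊃ y
  y≤ₜx⊃y x y = begin
    y                        ≈⟨ IB1 y y ⟨
    e ⊃ y                    ≈⟨ ⊃-cong (∨-absorbs-∧ e x) refl ⟨
    (e ∨ (e ∧ x)) ⊃ y        ≈⟨ IB4∨ e (e ∧ x) y ⟩
    (e ⊃ y) ∧ ((e ∧ x) ⊃ y)  ≈⟨ ∧-cong (IB1 y y) (sym (IB2∧ e x y)) ⟩
    y ∧ (e ⊃ (x ⊃ y))        ≈⟨ ∧-cong refl (IB1 y _) ⟩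
    y ∧ (x ⊃ y)              ∎
    where
    e = y ⊃ y
    open Alg.Lattice latticeₜ using (∨-absorbs-∧)

  infix 4 _⪯_

  -- Only a preorder: in the four-element bilattice it identifies `⊤` and `t`. Recovering equality
  -- therefore also requires comparing negations.
  _⪯_ : Rel Carrier ℓ
  x ⪯ y = Designated (x ⊃ y)

  ⪯-refl : x ⪯ x
  ⪯-refl = x⊃x-designated _

  ⪯-reflexive : x ≈ y → x ⪯ y
  ⪯-reflexive x≈y = designated-resp-≈ (⊃-cong refl x≈y) ⪯-refl

  ⪯-designated : Designated y → x ⪯ y
  ⪯-designated {y} {x} = designated-≤ₜ (y≤ₜx⊃y x y)

  ⪯-curry : x ∧ y ⪯ z → x ⪯ y ⊃ z
  ⪯-curry = designated-resp-≈ (sym (IB2∧ _ _ _))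

  ⪯-uncurry : x ⪯ y ⊃ z → x ∧ y ⪯ z
  ⪯-uncurry = designated-resp-≈ (IB2∧ _ _ _)

  x∧y⪯y : x ∧ y ⪯ y
  x∧y⪯y = ⪯-uncurry (⪯-designated ⪯-refl)

  x∧y⪯x : x ∧ y ⪯ x
  x∧y⪯x {x} {y} = designated-resp-≈ (⊃-cong (∧-comm y x) refl) x∧y⪯y
    where open Alg.Lattice latticeₜ using (∧-comm)

  ⪯⇒≤ₜ-⊗ : x ⪯ y → x ≤ₜ x ⊗ y
  ⪯⇒≤ₜ-⊗ {x} {y} d =
    trans (sym (IB5 x y)) (∧-cong refl (designated⇒⊃-identityˡ d _))

  -- Modus ponens under the premise `x`, in equational form: by (IB5) `x` is `x ∧ (x ⊗ y)`, and
  -- (IB2) unpacks this antecedent into the premises `x`, `x`, `y`.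
  ⊃-expand : x ⪯ y → ∀ z → x ⊃ z ≈ x ⊃ (y ⊃ z)
  ⊃-expand {x} {y} d z = begin
    x ⊃ z                  ≈⟨ ⊃-cong (⪯⇒≤ₜ-⊗ d) refl ⟩
    (x ∧ (x ⊗ y)) ⊃ z      ≈⟨ IB2∧ x (x ⊗ y) z ⟨
    x ⊃ ((x ⊗ y) ⊃ z)      ≈⟨ ⊃-cong refl (IB2⊗ x y z) ⟨
    x ⊃ ((x ∧ y) ⊃ z)      ≈⟨ ⊃-cong refl (IB2∧ x y z) ⟨
    x ⊃ (x ⊃ (y ⊃ z))      ≈⟨ IB2∧ x x (y ⊃ z) ⟩
    (x ∧ x) ⊃ (y ⊃ z)      ≈⟨ ⊃-cong (AlgLatticeProperties.∧-idem latticeₜ x) refl ⟩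
    x ⊃ (y ⊃ z)            ∎

  ⪯-mp : x ⪯ y ⊃ z → x ⪯ y → x ⪯ z
  ⪯-mp h d = designated-resp-≈ (sym (⊃-expand d _)) h

  ⪯-trans : x ⪯ y → y ⪯ z → x ⪯ z
  ⪯-trans d e = ⪯-mp (⪯-designated e) d

  ⊕-upper : ∀ x y → Designated ((x ⊃ (x ⊕ y)) ∧ (y ⊃ (x ⊕ y)))
  ⊕-upper x y = designated-resp-≈ (sym (IB4⊕ x y _)) ⪯-refl

  ⪯-antisym-¬ : x ⪯ y → y ⪯ x → ¬ x ⪯ ¬ y → ¬ y ⪯ ¬ x → x ≈ y
  ⪯-antisym-¬ x⪯y y⪯x ¬x⪯¬y ¬y⪯¬x =
    trans (≈⊗ x⪯y ¬x⪯¬y) (trans (⊗-comm _ _) (sym (≈⊗ y⪯x ¬y⪯¬x)))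
    where
    open Alg.Lattice latticeₖ using () renaming (∧-comm to ⊗-comm)

    ≈⊗ : x ⪯ y → ¬ x ⪯ ¬ y → x ≈ x ⊗ y
    ≈⊗ {x} {y} d e = T.antisym (⪯⇒≤ₜ-⊗ d)
      -- The converse inequality is the one between negations, reversed by `¬` and freed of double
      -- negations.
      (T.trans (T.reflexive (sym (¬-involutive (x ⊗ y))))
      (T.trans (¬-antitoneₜ (T.trans (⪯⇒≤ₜ-⊗ e) (T.reflexive (sym (¬-⊗ x y)))))
               (T.reflexive (¬-involutive x))))

-- The twist product of a lattice with relative pseudocomplements and Peirce's law.

module Twist
  (L : Lattice c ℓ ℓ)
  (_⇨_ : Op₂ (Lattice.Carrier L))
  (exponential : Exponential (Lattice._≤_ L) (Lattice._∧_ L) _⇨_)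
  (peirce : ∀ x y → Lattice._≤_ L ((x ⇨ y) ⇨ x) x)
  where

  open Lattice L
  open LatticeProperties L using (algLattice)
  open MeetProperties meetSemilattice using (∧-cong; ∧-comm; ∧-assoc; ∧-monotonic)
  open JoinProperties joinSemilattice using (∨-cong)

  private
    variable
      x y z w : Carrier

    -- Evidence against is ordered dually in the truth order, while the knowledge order increases
    -- with both kinds of evidence.
    module FT = Alg.Lattice
      (×-lattice algLattice (AlgLatticeProperties.∧-∨-lattice algLattice))
    module FK = Alg.Lattice (×-lattice algLattice algLattice)

  ⇨-curry : w ∧ x ≤ y → w ≤ x ⇨ y
  ⇨-curry = proj₁ (exponential _ _ _)

  ⇨-uncurry : w ≤ x ⇨ y → w ∧ x ≤ y
  ⇨-uncurry = proj₂ (exponential _ _ _)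

  ⇨-mp : w ≤ x ⇨ y → w ≤ x → w ≤ y
  ⇨-mp f a = trans (∧-greatest refl a) (⇨-uncurry f)

  ⇨-monotonic : x ≤ y → z ≤ w → y ⇨ z ≤ x ⇨ w
  ⇨-monotonic x≤y z≤w =
    ⇨-curry (trans (⇨-mp (x∧y≤x _ _) (trans (x∧y≤y _ _) x≤y)) z≤w)

  ⇨-cong : x ≈ y → z ≈ w → x ⇨ z ≈ y ⇨ w
  ⇨-cong x≈y z≈w = antisym
    (⇨-monotonic (reflexive (Eq.sym x≈y)) (reflexive z≈w))
    (⇨-monotonic (reflexive x≈y) (reflexive (Eq.sym z≈w)))

  x≤y⇨x : x ≤ y ⇨ x
  x≤y⇨x = ⇨-curry (x∧y≤x _ _)

  y≤x⇨x : y ≤ x ⇨ x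
  y≤x⇨x = ⇨-curry (x∧y≤y _ _)

  ⇨-∧-curry : ∀ x y z → x ⇨ (y ⇨ z) ≈ (x ∧ y) ⇨ z
  ⇨-∧-curry x y z = antisym
    (⇨-curry (⇨-mp (⇨-mp (x∧y≤x _ _) (trans (x∧y≤y _ _) (x∧y≤x x y)))
                   (trans (x∧y≤y _ _) (x∧y≤y x y))))
    (⇨-curry (⇨-curry (⇨-mp (trans (x∧y≤x _ _) (x∧y≤x _ _))
                            (∧-monotonic (x∧y≤y _ _) refl))))

  ∨-⇨ : ∀ x y z → (x ∨ y) ⇨ z ≈ (x ⇨ z) ∧ (y ⇨ z)
  ∨-⇨ x y z = antisym
    (∧-greatest (⇨-monotonic (x≤x∨y x y) refl) (⇨-monotonic (y≤x∨y x y) refl))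
    -- With the disjunction in front and both implications moved to the right as a premise, case
    -- analysis applies.
    (⇨-curry (trans (reflexive (∧-comm _ _)) (⇨-uncurry (∨-least
      (⇨-curry (⇨-mp (trans (x∧y≤y _ _) (x∧y≤x _ _)) (x∧y≤x _ _)))
      (⇨-curry (⇨-mp (trans (x∧y≤y _ _) (x∧y≤y _ _)) (x∧y≤x _ _)))))))

  -- Meeting with `z` has the right adjoint `z ⇨_`, so it preserves joins. This is the second
  -- coordinate of (IB4).
  ∧-distribʳ-∨ : ∀ x y z → (x ∨ y) ∧ z ≈ (x ∧ z) ∨ (y ∧ z)
  ∧-distribʳ-∨ x y z = antisym
    (⇨-uncurry (∨-least (⇨-curry (x≤x∨y _ _)) (⇨-curry (y≤x∨y _ _))))
    (∨-least (∧-monotonic (x≤x∨y x y) refl) (∧-monotonic (y≤x∨y x y) refl))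

  algebra : Algebra c ℓ
  algebra = record
    { Carrier       = Carrier × Carrier
    ; _≈_           = FT._≈_
    ; isEquivalence = FT.isEquivalence
    ; _∧_           = FT._∧_
    ; _∨_           = FT._∨_
    ; _⊗_           = FK._∧_
    ; _⊕_           = FK._∨_
    -- Evidence against an implication is evidence for its antecedent together with evidence against
    -- its consequent.
    ; _⊃_           = λ (x₁ , _) (y₁ , y₂) → x₁ ⇨ y₁ , x₁ ∧ y₂
    ; ¬_            = swap
    ; ∧-cong        = FT.∧-cong
    ; ∨-cong        = FT.∨-cong
    ; ⊗-cong        = FK.∧-cong
    ; ⊕-cong        = FK.∨-cong
    ; ⊃-cong        = λ (p₁ , _) (q₁ , q₂) → ⇨-cong p₁ q₁ , ∧-cong p₁ q₂
    ; ¬-cong        = swap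
    }

  isBilattice : IsBilattice algebra
  isBilattice = record
    { isLatticeₜ   = FT.isLattice
    ; isLatticeₖ   = FK.isLattice
    ; ¬-antitoneₜ  = λ (p₁ , p₂) → join p₂ , meet p₁
    ; ¬-monotoneₖ  = swap
    ; ¬-involutive = λ _ → Eq.refl , Eq.refl
    }
    where
    -- The dual coordinate states its inequality through `∨`; swapping coordinates calls for the
    -- equivalent form through `∧`, and conversely.
    join : x ≈ x ∨ y → y ≈ y ∧ x
    join p = antisym
      (∧-greatest refl (trans (y≤x∨y _ _) (reflexive (Eq.sym p)))) (x∧y≤x _ _)

    meet : x ≈ x ∧ y → y ≈ y ∨ x
    meet p = antisym
      (x≤x∨y _ _) (∨-least refl (trans (reflexive p) (x∧y≤y _ _)))

  isImplicativeBilattice : IsImplicativeBilattice algebra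
  isImplicativeBilattice = record
    { isBilattice = isBilattice
    ; IB1  = λ _ _ →
        antisym (⇨-mp refl y≤x⇨x) x≤y⇨x ,
        antisym (x∧y≤y _ _) (∧-greatest y≤x⇨x refl)
    ; IB2∧ = λ _ _ _ → ⇨-∧-curry _ _ _ , Eq.sym (∧-assoc _ _ _)
    -- Implication reads only the first coordinate of its antecedent, where `∧` and `⊗` agree by
    -- definition.
    ; IB2⊗ = λ _ _ _ → Eq.refl , Eq.refl
    ; IB3  = λ (x₁ , _) (y₁ , _) →
        ⇨-cong (peirce-≈ x₁ y₁) Eq.refl , ∧-cong (peirce-≈ x₁ y₁) Eq.refl
    ; IB4∨ = λ _ _ _ → ∨-⇨ _ _ _ , ∧-distribʳ-∨ _ _ _
    ; IB4⊕ = λ _ _ _ → Eq.sym (∨-⇨ _ _ _) , Eq.sym (∧-distribʳ-∨ _ _ _)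
    ; IB5  = λ _ _ →
        antisym (x∧y≤x _ _)
          (∧-greatest refl (⇨-curry (∧-greatest (x∧y≤x _ _) (⇨-mp (x∧y≤y _ _) (x∧y≤x _ _))))) ,
        antisym (∨-least refl (trans (x∧y≤y _ _) (x∧y≤x _ _))) (x≤x∨y _ _)
    ; IB6  = λ _ _ _ → Eq.refl , Eq.refl
    }
    where
    peirce-≈ : ∀ x y → (x ⇨ y) ⇨ x ≈ x
    peirce-≈ x y = antisym (peirce x y) x≤y⇨x

open import Defs

-- Soundness of the calculus, and equality as designated equivalence.

module _ {B : Algebra c ℓ} (isImplicative : IsImplicativeBilattice B) where
  open ImplicativeBilatticeProperties isImplicative
  open IsImplicativeBilattice isImplicative
  open IsBilattice isBilattice
  open BilatticeProperties isBilattice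
  private module B = Algebra B
  open IsEquivalence B.isEquivalence using (refl; sym)

  axiom-designated : ∀ (v : ℕ → B.Carrier) {φ} → Axiom φ → Designated (eval B v φ)
  axiom-designated v = designated
    where
    ⊃⊂-designated : ∀ {x y} → x B.≈ y → Designated ((x B.⊃ y) B.∧ (y B.⊃ x))
    ⊃⊂-designated x≈y = designated-∧ (⪯-reflexive x≈y) (⪯-reflexive (sym x≈y))

    designated : ∀ {φ} → Axiom φ → Designated (eval B v φ)
    designated (⊃1 p q)    = ⪯-curry x∧y⪯x
    -- Once the three premises are gathered by `∧`, three uses of modus ponens under that meet
    -- suffice.
    designated (⊃2 p q r)  = ⪯-curry (⪯-curry
      (⪯-mp (⪯-mp (⪯-trans x∧y⪯x x∧y⪯x) x∧y⪯y) (⪯-mp (⪯-trans x∧y⪯x x∧y⪯y) x∧y⪯y)))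
    designated (⊃3 p q)    = designated-resp-≈ (sym (IB3 _ _)) ⪯-refl
    designated (∧⊃ˡ p q)   = x∧y⪯x
    designated (∧⊃ʳ p q)   = x∧y⪯y
    designated (⊃∧ p q)    = ⪯-curry ⪯-refl
    designated (⊗⊃ˡ p q)   = designated-resp-≈ (IB2⊗ _ _ _) x∧y⪯x
    designated (⊗⊃ʳ p q)   = designated-resp-≈ (IB2⊗ _ _ _) x∧y⪯y
    designated (⊃⊗ p q)    = ⪯-curry (designated-resp-≈ (sym (IB2⊗ _ _ _)) ⪯-refl)
    designated (⊃∨ˡ p q)   = designated-∧⁻ˡ (designated-resp-≈ (IB4∨ _ _ _) ⪯-refl)
    designated (⊃∨ʳ p q)   = designated-∧⁻ʳ (designated-resp-≈ (IB4∨ _ _ _) ⪯-refl)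
    designated (∨⊃ p q r)  = ⪯-curry (⪯-reflexive (sym (IB4∨ _ _ _)))
    designated (⊃⊕ˡ p q)   = designated-∧⁻ˡ (⊕-upper _ _)
    designated (⊃⊕ʳ p q)   = designated-∧⁻ʳ (⊕-upper _ _)
    designated (⊕⊃ p q r)  = ⪯-curry (⪯-reflexive (IB4⊕ _ _ _))
    designated (¬∧ p q)    = ⊃⊂-designated (¬-∧ _ _)
    designated (¬∨ p q)    = ⊃⊂-designated (¬-∨ _ _)
    designated (¬⊗ p q)    = ⊃⊂-designated (¬-⊗ _ _)
    designated (¬⊕ p q)    = ⊃⊂-designated (¬-⊕ _ _)
    designated (¬⊃ p q)    = designated-∧
      (designated-resp-≈ (sym (IB6 _ _ _)) ⪯-refl)
      (designated-resp-≈ (IB6 _ _ _) ⪯-refl)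
    designated (¬¬ p)      = ⊃⊂-designated (sym (¬-involutive _))

  ⊢⇒designated : ∀ {Γ : Pred Fm ℓ₁} (v : ℕ → B.Carrier) →
                 (∀ {γ} → γ ∈ Γ → Designated (eval B v γ)) →
                 ∀ {φ} → Γ ⊢LB⊃ φ → Designated (eval B v φ)
  ⊢⇒designated v h (hyp φ∈Γ) = h φ∈Γ
  ⊢⇒designated v h (axiom a) = axiom-designated v a
  ⊢⇒designated v h (mp d e)  = designated-mp (⊢⇒designated v h d) (⊢⇒designated v h e)

  ≈⇒⟷-designated : ∀ v φ ψ → eval B v φ B.≈ eval B v ψ → Designated (eval B v (φ ⟷ ψ))
  ≈⇒⟷-designated v φ ψ p = designated-∧
    (designated-∧ (⪯-reflexive p) (⪯-reflexive (B.¬-cong (sym p))))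
    (designated-∧ (⪯-reflexive (sym p)) (⪯-reflexive (B.¬-cong p)))

  ⟷-designated⇒≈ : ∀ v φ ψ → Designated (eval B v (φ ⟷ ψ)) → eval B v φ B.≈ eval B v ψ
  ⟷-designated⇒≈ v φ ψ d = ⪯-antisym-¬
    -- The contrapositive half of each strong implication compares the negations in the opposite
    -- direction.
    (designated-∧⁻ˡ φ→ψ) (designated-∧⁻ˡ ψ→φ) (designated-∧⁻ʳ ψ→φ) (designated-∧⁻ʳ φ→ψ)
    where
    φ→ψ = designated-∧⁻ˡ d
    ψ→φ = designated-∧⁻ʳ d

-- Completeness through the twist product of the formula lattice.

module Lindenbaum (c : Level) {ℓ} (Γ : Pred Fm ℓ) where

  private
    variable
      p q r : Fm

  infix 4 _≤_

  _≤_ : Rel Fm ℓ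
  p ≤ q = Γ ⊢LB⊃ p ⊃ q

  const : Γ ⊢LB⊃ p → q ≤ p
  const d = mp d (axiom (⊃1 _ _))

  apply : p ≤ q ⊃ r → p ≤ q → p ≤ r
  apply d e = mp e (mp d (axiom (⊃2 _ _ _)))

  ≤-refl : p ≤ p
  ≤-refl {p} = apply {q = p ⊃ p} (axiom (⊃1 _ _)) (axiom (⊃1 _ _))

  ≤-trans : p ≤ q → q ≤ r → p ≤ r
  ≤-trans d e = apply (const e) d

  ∧-greatest : r ≤ p → r ≤ q → r ≤ p ∧ q
  ∧-greatest d e = apply (≤-trans d (axiom (⊃∧ _ _))) e

  ∨-least : p ≤ r → q ≤ r → p ∨ q ≤ r
  ∨-least d e = mp e (mp d (axiom (∨⊃ _ _ _)))

  ⊕-least : p ≤ r → q ≤ r → p ⊕ q ≤ r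
  ⊕-least d e = mp e (mp d (axiom (⊕⊃ _ _ _)))

  ⊃-curry : p ∧ q ≤ r → p ≤ q ⊃ r
  -- Weakening `d` by `q` and distributing gives `(q ⊃ p ∧ q) ⊃ (q ⊃ r)`.
  ⊃-curry d = apply (const (mp (const d) (axiom (⊃2 _ _ _)))) (axiom (⊃∧ _ _))

  ⊃-uncurry : p ≤ q ⊃ r → p ∧ q ≤ r
  ⊃-uncurry d = apply (≤-trans (axiom (∧⊃ˡ _ _)) d) (axiom (∧⊃ʳ _ _))

  -- Interderivable formulas are equal here, so no quotient is formed. Negation need not respect
  -- this equality; the twist product supplies it by swapping. The lift meets the arbitrary carrier
  -- level `c`.
  lattice : Lattice c ℓ ℓ
  lattice = record
    { Carrier   = Lift c Fm
    ; _≈_       = Interior.SymInterior λ p q → lower p ≤ lower q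
    ; _≤_       = λ p q → lower p ≤ lower q
    ; _∨_       = λ p q → lift (lower p ∨ lower q)
    ; _∧_       = λ p q → lift (lower p ∧ lower q)
    ; isLattice = record
      { isPartialOrder = Interior.isPartialOrder ≤-refl ≤-trans
      ; supremum       = λ _ _ → axiom (⊃∨ˡ _ _) , axiom (⊃∨ʳ _ _) , λ _ → ∨-least
      ; infimum        = λ _ _ → axiom (∧⊃ˡ _ _) , axiom (∧⊃ʳ _ _) , λ _ → ∧-greatest
      }
    }

  private
    _⇨_ : Op₂ (Lift c Fm)
    p ⇨ q = lift (lower p ⊃ lower q)

    exponential : Exponential (Lattice._≤_ lattice) (Lattice._∧_ lattice) _⇨_
    exponential _ _ _ = ⊃-curry , ⊃-uncurry

    peirce : ∀ p q → Lattice._≤_ lattice ((p ⇨ q) ⇨ p) p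
    peirce _ _ = axiom (⊃3 _ _)

  open Twist lattice _⇨_ exponential peirce public
    using (algebra; isImplicativeBilattice)

  private
    module F = Algebra algebra
    module F≈ = IsEquivalence F.isEquivalence

  ⟪_⟫ : Fm → F.Carrier
  ⟪ φ ⟫ = lift φ , lift (¬ φ)

  valuation : ℕ → F.Carrier
  valuation n = ⟪ var n ⟫

  ⊃⊂ˡ : Axiom (p ⊃⊂ q) → p ≤ q
  ⊃⊂ˡ a = mp (axiom a) (axiom (∧⊃ˡ _ _))

  ⊃⊂ʳ : Axiom (p ⊃⊂ q) → q ≤ p
  ⊃⊂ʳ a = mp (axiom a) (axiom (∧⊃ʳ _ _))

  ⊗≤∧ : p ⊗ q ≤ p ∧ q
  ⊗≤∧ = ∧-greatest (axiom (⊗⊃ˡ _ _)) (axiom (⊗⊃ʳ _ _))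

  ∧≤⊗ : p ∧ q ≤ p ⊗ q
  ∧≤⊗ = ⊃-uncurry (axiom (⊃⊗ _ _))

  ⊕≤∨ : p ⊕ q ≤ p ∨ q
  ⊕≤∨ = ⊕-least (axiom (⊃∨ˡ _ _)) (axiom (⊃∨ʳ _ _))

  ∨≤⊕ : p ∨ q ≤ p ⊕ q
  ∨≤⊕ = ∨-least (axiom (⊃⊕ˡ _ _)) (axiom (⊃⊕ʳ _ _))

  -- By induction: each second coordinate is the negation axiom of the connective. For `⊗` and `⊕`,
  -- interpreted coordinatewise by `∧` and `∨`, the interderivability with these is used as well.
  eval≈⟪⟫ : ∀ φ → eval algebra valuation φ F.≈ ⟪ φ ⟫
  eval≈⟪⟫ (var n) = F≈.refl
  eval≈⟪⟫ (φ ∧ ψ) = F≈.trans (F.∧-cong (eval≈⟪⟫ φ) (eval≈⟪⟫ ψ))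
    ((≤-refl , ≤-refl) , (⊃⊂ʳ (¬∧ φ ψ) , ⊃⊂ˡ (¬∧ φ ψ)))
  eval≈⟪⟫ (φ ∨ ψ) = F≈.trans (F.∨-cong (eval≈⟪⟫ φ) (eval≈⟪⟫ ψ))
    ((≤-refl , ≤-refl) , (⊃⊂ʳ (¬∨ φ ψ) , ⊃⊂ˡ (¬∨ φ ψ)))
  eval≈⟪⟫ (φ ⊗ ψ) = F≈.trans (F.⊗-cong (eval≈⟪⟫ φ) (eval≈⟪⟫ ψ))
    ((∧≤⊗ , ⊗≤∧) , (≤-trans ∧≤⊗ (⊃⊂ʳ (¬⊗ φ ψ)) , ≤-trans (⊃⊂ˡ (¬⊗ φ ψ)) ⊗≤∧))
  eval≈⟪⟫ (φ ⊕ ψ) = F≈.trans (F.⊕-cong (eval≈⟪⟫ φ) (eval≈⟪⟫ ψ))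
    ((∨≤⊕ , ⊕≤∨) , (≤-trans ∨≤⊕ (⊃⊂ʳ (¬⊕ φ ψ)) , ≤-trans (⊃⊂ˡ (¬⊕ φ ψ)) ⊕≤∨))
  eval≈⟪⟫ (φ ⊃ ψ) = F≈.trans (F.⊃-cong (eval≈⟪⟫ φ) (eval≈⟪⟫ ψ))
    ((≤-refl , ≤-refl) , (⊃⊂ʳ (¬⊃ φ ψ) , ⊃⊂ˡ (¬⊃ φ ψ)))
  eval≈⟪⟫ (¬ φ)   = F≈.trans (F.¬-cong (eval≈⟪⟫ φ))
    ((≤-refl , ≤-refl) , (⊃⊂ˡ (¬¬ φ) , ⊃⊂ʳ (¬¬ φ)))

  open ImplicativeBilatticeProperties isImplicativeBilattice using (Designated; designated-resp-≈)

  ⊢⇒designated-eval : ∀ {φ} → Γ ⊢LB⊃ φ → Designated (eval algebra valuation φ)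
  ⊢⇒designated-eval {φ} d = designated-resp-≈ (F≈.sym (eval≈⟪⟫ φ))
    -- The pair `φ , ¬ φ` must equal `φ ⊃ φ , φ ∧ ¬ φ`; derivability of `φ` closes the gap in both
    -- coordinates.
    ( (const ≤-refl , const d)
    , (∧-greatest (const d) ≤-refl , axiom (∧⊃ʳ _ _)))

  designated-eval⇒⊢ : ∀ {φ} → Designated (eval algebra valuation φ) → Γ ⊢LB⊃ φ
  designated-eval⇒⊢ {φ} d =
    -- The first coordinate yields `(φ ⊃ φ) ⊃ φ`.
    mp ≤-refl (rhs≤lhs (proj₁ (designated-resp-≈ (eval≈⟪⟫ φ) d)))

theorem4p3p10 : (c ℓ : Level) → Algebraizable {ℓ = ℓ} _⊢LB⊃_ (ImpBiLat c ℓ) _⟷_ (λ φ → φ ≈ φ ⊃ φ)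
theorem4p3p10 c ℓ = record
  { consequence = λ Γ φ → mk⇔
      (λ d B B∈K v h → ⊢⇒designated B∈K v (λ γ∈Γ → h _ (_ , γ∈Γ , ≡.refl)) d)
      -- The entailment is tested on the one algebra built from `Γ`, where each member of `Γ` is
      -- designated because it is derivable.
      (λ h → let open Lindenbaum c Γ in
        designated-eval⇒⊢ (h algebra isImplicativeBilattice valuation
          λ { _ (_ , γ∈Γ , ≡.refl) → ⊢⇒designated-eval (hyp γ∈Γ) }))
  ; to          = λ φ ψ B B∈K v h → ≈⇒⟷-designated B∈K v φ ψ (h _ ≡.refl)
  ; from        = λ φ ψ B B∈K v h → ⟷-designated⇒≈ B∈K v φ ψ (h _ ≡.refl)
  }
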